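{- Let $n>1$ be an integer. Then $$\sum_{k=0}^{n-1}(3k+1)(-16)^{n-k-1}\binom{2k}{k} f_k \equiv 0 \pmod{n\binom{2n}{n}},$$ i.e. the integer on the left is divisible by $n\binom{2n}{n}$.
   Context: The Franel numbers are defined by $f_n=\sum_{k=0}^n \binom{n}{k}^3$ for integers $n\ge 0$. -}

module Defs where

open import Data.Nat.Base using (ℕ; suc; _^_)
open import Data.Nat.Combinatorics using (_C_)
open import Data.Nat.ListAction using (sum)
open import Data.Integer.Base using (ℤ; 0ℤ; _+_)
open import Data.List.Base using (applyUpTo; foldr)

franel : ℕ → ℕ
franel n = sum (applyUpTo (λ k → (n C k) ^ 3) (suc n))

-- The upper bound is exclusive: ∑< n f = f 0 + ⋯ + f (n − 1).
∑< : ℕ → (ℕ → ℤ) → ℤ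
∑< n f = foldr _+_ 0ℤ (applyUpTo f n)

{-# OPTIONS --safe #-}
-- Write S n for the sum and f for the Franel numbers. The expansion
--   f n = ∑ⱼ (−4)ⁿ⁻ʲ (n + 2j)! / ((n − j)! j!³)
-- holds because both sides satisfy Franel's recurrence
--   (n + 1)² x (n + 1) = (7n² + 7n + 2) x n + 8n² x (n − 1).
-- After substituting it, the sum over k in S n becomes Gosper-summable for each
-- fixed j, and the outcome is
--   2 S n = n C(2n, n) ∑_{j<n} (−4)ⁿ⁻¹⁻ʲ C(n + 2j, 3j + 1) C(3j + 1, j) C(2j, j).
-- Every term on the right is even when n > 1: for j < n − 1 because of the power
-- of −4, and for j ≥ 1 because C(2j, j) is even.
module Submission where

open import Defs
open import Data.Nat.Base using (ℕ; zero; suc; _<_; _∸_; s≤s; z≤n; >-nonZero) renaming (_+_ to _+ℕ_; _*_ to _*ℕ_; _^_ to _^ℕ_)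
open import Data.Nat.Properties using (n<1+n; m<n⇒m<1+n; <⇒≤; ≰⇒>; _≤?_; +-suc; *-suc; +-monoʳ-<; +-∸-assoc; m+n∸n≡m; suc-pred; m<n⇒0<n∸m) renaming (+-comm to +ℕ-comm; *-comm to *ℕ-comm)
open import Data.Nat.Combinatorics using (_C_; nC1≡n; k>n⇒nCk≡0; nCk+nC[k+1]≡[n+1]C[k+1])
open import Data.Nat.ListAction using (sum)
open import Data.Integer.Base using (ℤ; +_; -_; _*_; _^_; _+_; _-_; 0ℤ; NonZero)
open import Data.Integer.Properties using (pos-*; +-assoc; +-identityˡ; +-identityʳ; *-assoc; *-comm; *-identityʳ; *-zeroʳ; *-distribˡ-+; *-cancelˡ-≡; i*j≢0; +-0-abelianGroup)
open import Data.Integer.Divisibility.Signed using (_∣_; divides; ∣m∣n⇒∣m+n; ∣m⇒∣m*n; ∣n⇒∣m*n)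
open import Data.Integer.Tactic.RingSolver using (solve; solve-∀)
open import Data.List.Base using ([]; _∷_; applyUpTo)
open import Data.Product.Base using (_×_; _,_; proj₁)
open import Function.Base using (_∘_; it)
open import Relation.Nullary.Decidable using (yes; no)
open import Relation.Binary.PropositionalEquality using (_≡_; refl; sym; trans; cong; cong₂; subst; module ≡-Reasoning)
open import Algebra.Properties.AbelianGroup +-0-abelianGroup using () renaming (∙-cancelʳ to +-cancelʳ)

open ≡-Reasoning

-- The linear-combination pattern of most `step` lemmas: `u ≡ v` is assembled from multiples of the
-- hypotheses or of their cubes, and `x + v ≡ y + u` is then a polynomial identity for the ring
-- solver.
by-combination : ∀ {x y u v : ℤ} → u ≡ v → x + v ≡ y + u → x ≡ y
by-combination {x} {y} {u} refl eq = +-cancelʳ u x y eq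

-- Binomial coefficients as integers, and their index shifts

-- Opaque because _C_ computes by cases on its arguments, which blocks unification.
opaque
  binom : ℕ → ℕ → ℤ
  binom n k = + (n C k)

  binom-C : ∀ n k → + (n C k) ≡ binom n k
  binom-C n k = refl

pascal : ∀ n k → binom (suc n) (suc k) ≡ binom n k + binom n (suc k)
pascal n k = begin
  binom (suc n) (suc k)          ≡⟨ binom-C (suc n) (suc k) ⟨
  + (suc n C suc k)              ≡⟨ cong +_ (nCk+nC[k+1]≡[n+1]C[k+1] n k) ⟨
  + (n C k) + + (n C suc k)      ≡⟨ cong₂ _+_ (binom-C n k) (binom-C n (suc k)) ⟩
  binom n k + binom n (suc k)    ∎

binom-vanish : ∀ {n k} → n < k → binom n k ≡ 0ℤ
binom-vanish {n} {k} n<k = trans (sym (binom-C n k)) (cong +_ (k>n⇒nCk≡0 n<k))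

binom-0 : ∀ n → binom n 0 ≡ + 1
binom-0 n = trans (sym (binom-C n 0)) refl

binom-1 : ∀ n → binom n 1 ≡ + n
binom-1 n = trans (sym (binom-C n 1)) (cong +_ (nC1≡n n))

absorption : ∀ n k → + suc k * binom (suc n) (suc k) ≡ + suc n * binom n k
absorption n       zero    = begin
  + 1 * binom (suc n) 1  ≡⟨ cong (+ 1 *_) (binom-1 (suc n)) ⟩
  + 1 * + suc n          ≡⟨ *-comm (+ 1) (+ suc n) ⟩
  + suc n * + 1          ≡⟨ cong (+ suc n *_) (binom-0 n) ⟨
  + suc n * binom n 0    ∎
absorption zero    (suc k) = begin
  + suc (suc k) * binom 1 (suc (suc k))  ≡⟨ cong (+ suc (suc k) *_) (binom-vanish (s≤s (s≤s z≤n))) ⟩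
  + suc (suc k) * 0ℤ                     ≡⟨ *-zeroʳ (+ suc (suc k)) ⟩
  + 1 * 0ℤ                               ≡⟨ cong (+ 1 *_) (binom-vanish {0} {suc k} (s≤s z≤n)) ⟨
  + 1 * binom 0 (suc k)                  ∎
absorption (suc n) (suc k) =
  step (+ n) (+ k) _ _ _ _ _ (pascal (suc n) (suc k)) (pascal n k) (absorption n k) (absorption n (suc k))
  where
  step : ∀ n k a b c d e → a ≡ b + c → b ≡ d + e → (+ 1 + k) * b ≡ (+ 1 + n) * d →
    (+ 2 + k) * c ≡ (+ 1 + n) * e → (+ 2 + k) * a ≡ (+ 2 + n) * b
  step n k _ _ c d e refl refl h₁ h₂ = by-combination (cong₂ _+_ h₁ h₂) (solve (n ∷ k ∷ c ∷ d ∷ e ∷ []))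

lower-shift : ∀ n k → + suc k * binom n (suc k) ≡ (+ n - + k) * binom n k
lower-shift n k = step (+ n) (+ k) _ _ _ (pascal n k) (absorption n k)
  where
  step : ∀ n k a b c → a ≡ b + c → (+ 1 + k) * a ≡ (+ 1 + n) * b → (+ 1 + k) * c ≡ (n - k) * b
  step n k _ b c refl h = by-combination h (solve (n ∷ k ∷ b ∷ c ∷ []))

upper-shift : ∀ n k → + suc n * binom n k ≡ (+ suc n - + k) * binom (suc n) k
upper-shift n k = trans (sym (absorption n k)) (lower-shift (suc n) k)

-- Passing from `j` to `suc j` in `expansionTerm` raises the lower index by three and the upper one
-- by two plus the change of `n`. This lemma and the next two bring the three neighbours in Franel's
-- recurrence back to one binomial.
binom-shift₃₃ : ∀ n k →
  (+ 3 + + k) * (+ 2 + + k) * (+ 1 + + k) * binom (3 +ℕ n) (3 +ℕ k)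
    ≡ (+ 3 + + n) * (+ 2 + + n) * (+ 1 + + n) * binom n k
binom-shift₃₃ n k = step (+ n) (+ k) _ _ _ _
  (absorption (2 +ℕ n) (2 +ℕ k)) (absorption (1 +ℕ n) (1 +ℕ k)) (absorption n k)
  where
  step : ∀ n k a b c d → (+ 3 + k) * a ≡ (+ 3 + n) * b → (+ 2 + k) * b ≡ (+ 2 + n) * c →
    (+ 1 + k) * c ≡ (+ 1 + n) * d →
    (+ 3 + k) * (+ 2 + k) * (+ 1 + k) * a ≡ (+ 3 + n) * (+ 2 + n) * (+ 1 + n) * d
  step n k a b c d h₁ h₂ h₃ = by-combination
    (cong₂ _+_ (cong ((+ 2 + k) * (+ 1 + k) *_) h₁)
      (cong₂ _+_ (cong ((+ 1 + k) * (+ 3 + n) *_) h₂) (cong ((+ 3 + n) * (+ 2 + n) *_) h₃)))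
    (solve (n ∷ k ∷ a ∷ b ∷ c ∷ d ∷ []))

binom-shift₂₃ : ∀ n k →
  (+ 3 + + k) * (+ 2 + + k) * (+ 1 + + k) * binom (2 +ℕ n) (3 +ℕ k)
    ≡ (+ 2 + + n) * (+ 1 + + n) * (+ n - + k) * binom n k
binom-shift₂₃ n k = step (+ n) (+ k) _ _ _ _
  (absorption (1 +ℕ n) (2 +ℕ k)) (absorption n (1 +ℕ k)) (lower-shift n k)
  where
  step : ∀ n k a b c d → (+ 3 + k) * a ≡ (+ 2 + n) * b → (+ 2 + k) * b ≡ (+ 1 + n) * c →
    (+ 1 + k) * c ≡ (n - k) * d →
    (+ 3 + k) * (+ 2 + k) * (+ 1 + k) * a ≡ (+ 2 + n) * (+ 1 + n) * (n - k) * d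
  step n k a b c d h₁ h₂ h₃ = by-combination
    (cong₂ _+_ (cong ((+ 2 + k) * (+ 1 + k) *_) h₁)
      (cong₂ _+_ (cong ((+ 1 + k) * (+ 2 + n) *_) h₂) (cong ((+ 2 + n) * (+ 1 + n) *_) h₃)))
    (solve (n ∷ k ∷ a ∷ b ∷ c ∷ d ∷ []))

binom-shift₁₃ : ∀ n k →
  (+ 3 + + k) * (+ 2 + + k) * (+ 1 + + k) * binom (1 +ℕ n) (3 +ℕ k)
    ≡ (+ 1 + + n) * (+ n - + k) * (+ n - + k - + 1) * binom n k
binom-shift₁₃ n k = step (+ n) (+ k) _ _ _ _
  (absorption n (2 +ℕ k)) (lower-shift n (1 +ℕ k)) (lower-shift n k)
  where
  step : ∀ n k a b c d → (+ 3 + k) * a ≡ (+ 1 + n) * b → (+ 2 + k) * b ≡ (n - (+ 1 + k)) * c →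
    (+ 1 + k) * c ≡ (n - k) * d →
    (+ 3 + k) * (+ 2 + k) * (+ 1 + k) * a ≡ (+ 1 + n) * (n - k) * (n - k - + 1) * d
  step n k a b c d h₁ h₂ h₃ = by-combination
    (cong₂ _+_ (cong ((+ 2 + k) * (+ 1 + k) *_) h₁)
      (cong₂ _+_ (cong ((+ 1 + k) * (+ 1 + n) *_) h₂) (cong ((+ 1 + n) * (n - k - + 1) *_) h₃)))
    (solve (n ∷ k ∷ a ∷ b ∷ c ∷ d ∷ []))

^-nonZero : ∀ i n .⦃ _ : NonZero i ⦄ → NonZero (i ^ n)
^-nonZero i zero    = _
^-nonZero i (suc n) = i*j≢0 i (i ^ n) ⦃ it ⦄ ⦃ ^-nonZero i n ⦄

-- Finite sums and telescoping

∑<-last : ∀ n f → ∑< (suc n) f ≡ ∑< n f + f n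
∑<-last zero    f = trans (+-identityʳ (f 0)) (sym (+-identityˡ (f 0)))
∑<-last (suc n) f = begin
  f 0 + ∑< (suc n) (f ∘ suc)          ≡⟨ cong (λ x → f 0 + x) (∑<-last n (f ∘ suc)) ⟩
  f 0 + (∑< n (f ∘ suc) + f (suc n))  ≡⟨ +-assoc (f 0) _ _ ⟨
  ∑< (suc n) f + f (suc n)            ∎

∑<-extend : ∀ n f → f n ≡ 0ℤ → ∑< (suc n) f ≡ ∑< n f
∑<-extend n f fn≡0 = trans (∑<-last n f) (trans (cong (λ x → ∑< n f + x) fn≡0) (+-identityʳ _))

-- `H k` is the partial sum up to and including index `k`, so the term at 0 is `H 0` itself and no
-- value before 0 is involved.
∑<-telescope : ∀ (w a b c : ℤ) (f g h H : ℕ → ℤ) →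
  w * (a * f 0 + b * g 0 + c * h 0) ≡ H 0 →
  (∀ k → w * (a * f (suc k) + b * g (suc k) + c * h (suc k)) ≡ H (suc k) - H k) →
  ∀ n → w * (a * ∑< (suc n) f + b * ∑< (suc n) g + c * ∑< (suc n) h) ≡ H n
∑<-telescope w a b c f g h H h₀ hₛ zero =
  trans (cong (w *_) (cong₂ _+_ (cong₂ _+_ (unit a (f 0)) (unit b (g 0))) (unit c (h 0)))) h₀
  where
  unit : ∀ x y → x * (y + 0ℤ) ≡ x * y
  unit x y = cong (x *_) (+-identityʳ y)
∑<-telescope w a b c f g h H h₀ hₛ (suc n) =
  step _ _ _ _ _ _ _ _ _ (H n) (H (suc n)) (∑<-last (suc n) f) (∑<-last (suc n) g) (∑<-last (suc n) h)
    (∑<-telescope w a b c f g h H h₀ hₛ n) (hₛ n)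
  where
  step : ∀ F G K F′ G′ K′ x y z p q → F′ ≡ F + x → G′ ≡ G + y → K′ ≡ K + z →
    w * (a * F + b * G + c * K) ≡ p → w * (a * x + b * y + c * z) ≡ q - p →
    w * (a * F′ + b * G′ + c * K′) ≡ q
  step F G K _ _ _ x y z p q refl refl refl h₁ h₂ = by-combination (cong₂ _+_ h₁ h₂)
    (solve (w ∷ a ∷ b ∷ c ∷ F ∷ G ∷ K ∷ x ∷ y ∷ z ∷ p ∷ q ∷ []))

-- Franel's recurrence and creative telescoping

franelOperator : ℤ → ℤ → ℤ → ℤ → ℤ
franelOperator n x y z =
  (n + + 1) ^ 2 * x + - (+ 7 * n ^ 2 + + 7 * n + + 2) * y + - (+ 8 * n ^ 2) * z

-- Indexed by `m = n − 1`, which avoids a truncated predecessor and makes the entries at 0 and 1 the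
-- initial values.
FranelRecurrence : (ℕ → ℤ) → Set
FranelRecurrence x = ∀ m → franelOperator (+ suc m) (x (2 +ℕ m)) (x (1 +ℕ m)) (x m) ≡ 0ℤ

-- The leading coefficient `(n + 1)²` never vanishes, so each entry is determined by the two before
-- it; the induction carries two consecutive equalities.
franelRecurrence-unique : ∀ {x y} → FranelRecurrence x → FranelRecurrence y →
  x 0 ≡ y 0 → x 1 ≡ y 1 → ∀ n → x n ≡ y n
franelRecurrence-unique {x} {y} rx ry x₀≡y₀ x₁≡y₁ = proj₁ ∘ both
  where
  step : ∀ a b c x₂ y₂ x₁ y₁ x₀ y₀ → x₁ ≡ y₁ → x₀ ≡ y₀ →
    a * x₂ + - b * x₁ + - c * x₀ ≡ a * y₂ + - b * y₁ + - c * y₀ → a * x₂ ≡ a * y₂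
  step a b c x₂ y₂ x₁ _ x₀ _ refl refl h =
    by-combination h (solve (a ∷ b ∷ c ∷ x₂ ∷ y₂ ∷ x₁ ∷ x₀ ∷ []))
  both : ∀ n → x n ≡ y n × x (suc n) ≡ y (suc n)
  both zero    = x₀≡y₀ , x₁≡y₁
  both (suc m) with both m
  ... | eq₀ , eq₁ = eq₁ , *-cancelˡ-≡ ((n + + 1) ^ 2) _ _ ⦃ ^-nonZero (n + + 1) 2 ⦄
      (step ((n + + 1) ^ 2) (+ 7 * n ^ 2 + + 7 * n + + 2) (+ 8 * n ^ 2)
        (x (2 +ℕ m)) (y (2 +ℕ m)) (x (1 +ℕ m)) (y (1 +ℕ m)) (x m) (y m)
        eq₁ eq₀ (trans (rx m) (sym (ry m))))
    where
    n = + suc m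

-- Creative telescoping with certificate `H`: terms outside the triangle vanish, so the three sums
-- can be padded to a common length, and the nonzero weight `w`, which keeps the certificate
-- integral, is cancelled at the end.
zeilberger : (t : ℕ → ℕ → ℤ) (w : ℕ → ℤ) (H : ℕ → ℕ → ℤ) →
  (∀ {n k} → n < k → t n k ≡ 0ℤ) →
  (∀ m → NonZero (w m)) →
  (∀ m → H m (2 +ℕ m) ≡ 0ℤ) →
  (∀ m → w m * franelOperator (+ suc m) (t (2 +ℕ m) 0) (t (1 +ℕ m) 0) (t m 0) ≡ H m 0) →
  (∀ m k → w m * franelOperator (+ suc m) (t (2 +ℕ m) (suc k)) (t (1 +ℕ m) (suc k)) (t m (suc k))
    ≡ H m (suc k) - H m k) →
  FranelRecurrence (λ n → ∑< (suc n) (t n))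
zeilberger t w H vanish w≢0 H-end H-start H-step m = *-cancelˡ-≡ (w m) _ _ ⦃ w≢0 m ⦄
  (trans (cong (λ x → w m * x) extended) (trans telescoped (sym (*-zeroʳ (w m)))))
  where
  n = + suc m
  telescoped : w m * franelOperator n
    (∑< (3 +ℕ m) (t (2 +ℕ m))) (∑< (3 +ℕ m) (t (1 +ℕ m))) (∑< (3 +ℕ m) (t m)) ≡ 0ℤ
  telescoped = trans
    (∑<-telescope (w m) ((n + + 1) ^ 2) (- (+ 7 * n ^ 2 + + 7 * n + + 2)) (- (+ 8 * n ^ 2))
      (t (2 +ℕ m)) (t (1 +ℕ m)) (t m) (H m) (H-start m) (H-step m) (2 +ℕ m))
    (H-end m)
  extended : franelOperator n (∑< (3 +ℕ m) (t (2 +ℕ m))) (∑< (2 +ℕ m) (t (1 +ℕ m))) (∑< (1 +ℕ m) (t m))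
    ≡ franelOperator n (∑< (3 +ℕ m) (t (2 +ℕ m))) (∑< (3 +ℕ m) (t (1 +ℕ m))) (∑< (3 +ℕ m) (t m))
  extended = sym (cong₂ (franelOperator n (∑< (3 +ℕ m) (t (2 +ℕ m))))
    (∑<-extend (2 +ℕ m) (t (1 +ℕ m)) (vanish (n<1+n _)))
    (trans (∑<-extend (2 +ℕ m) (t m) (vanish (m<n⇒m<1+n (n<1+n _))))
           (∑<-extend (1 +ℕ m) (t m) (vanish (n<1+n _)))))

-- Franel's recurrence for the sum of cubes

franelTerm : ℕ → ℕ → ℤ
franelTerm n k = binom n k ^ 3

+franel : ∀ n → + franel n ≡ ∑< (suc n) (franelTerm n)
+franel n = go (suc n) (λ k → n C k) (binom n) (λ k → binom-C n k)
  where
  +cube : ∀ c → + (c ^ℕ 3) ≡ (+ c) ^ 3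
  +cube c = begin
    + (c *ℕ (c *ℕ (c *ℕ 1)))   ≡⟨ pos-* c _ ⟩
    + c * + (c *ℕ (c *ℕ 1))    ≡⟨ cong (+ c *_) (pos-* c _) ⟩
    + c * (+ c * + (c *ℕ 1))   ≡⟨ cong (λ x → + c * (+ c * x)) (pos-* c 1) ⟩
    (+ c) ^ 3                  ∎
  go : ∀ l (f : ℕ → ℕ) (g : ℕ → ℤ) → (∀ k → + f k ≡ g k) →
    + sum (applyUpTo (λ k → f k ^ℕ 3) l) ≡ ∑< l (λ k → g k ^ 3)
  go zero    f g eq = refl
  go (suc l) f g eq =
    cong₂ _+_ (trans (+cube (f 0)) (cong (_^ 3) (eq 0))) (go l (f ∘ suc) (g ∘ suc) (eq ∘ suc))

-- Writing P for this polynomial and G(k) = P(n, k) C(n, k - 1)³, the recurrence operator applied to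
-- C(n, k)³ and multiplied by `n` equals G(k + 1) - G(k).
franelCertificate : ℤ → ℤ → ℤ
franelCertificate n k = + 4 * k ^ 3 - (+ 18 * n + + 12) * k ^ 2
  + (+ 27 * n ^ 2 + + 39 * n + + 12) * k - (+ 14 * n ^ 3 + + 32 * n ^ 2 + + 22 * n + + 4)

∑-franelTerm-recurrence : FranelRecurrence (λ n → ∑< (suc n) (franelTerm n))
-- The weight `n = suc m` turns `n ^ 2 * binom m k ^ 3` into the cube of `+ suc m * binom m k`,
-- which `upper-shift` rewrites.
∑-franelTerm-recurrence = zeilberger franelTerm (λ m → + suc m)
  (λ m k → franelCertificate (+ suc m) (+ suc k) * franelTerm (suc m) k)
  vanish _
  (λ m → trans (cong (franelCertificate (+ suc m) (+ (3 +ℕ m)) *_) (vanish (n<1+n _)))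
               (*-zeroʳ (franelCertificate (+ suc m) (+ (3 +ℕ m)))))
  (λ m → start (+ m) _ _ _ (binom-0 (2 +ℕ m)) (binom-0 (1 +ℕ m)) (binom-0 m))
  -- Multiplying by `(+ suc k) ^ 3` clears the denominators of the ratios between neighbouring
  -- binomials.
  (λ m k → *-cancelˡ-≡ ((+ suc k) ^ 3) _ _ ⦃ ^-nonZero (+ suc k) 3 ⦄
    (step (+ m) (+ k) _ _ _ _ (absorption (suc m) k) (lower-shift (suc m) k) (upper-shift m (suc k))))
  where
  vanish : ∀ {n k} → n < k → franelTerm n k ≡ 0ℤ
  vanish n<k = cong (_^ 3) (binom-vanish n<k)
  start : ∀ m a b c → a ≡ + 1 → b ≡ + 1 → c ≡ + 1 →
    (+ 1 + m) * franelOperator (+ 1 + m) (a ^ 3) (b ^ 3) (c ^ 3) ≡ franelCertificate (+ 1 + m) (+ 1) * b ^ 3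
  start m _ _ _ refl refl refl = identity m
    where
    -- The ring solver does not see through _^_, hence the unfolded powers here and below.
    identity : ∀ m →
      let n = + 1 + m
          _² = λ x → x * (x * + 1)
          _³ = λ x → x * (x * (x * + 1)) in
      n * ((n + + 1) ² * + 1 + - (+ 7 * n ² + + 7 * n + + 2) * + 1 + - (+ 8 * n ²) * + 1)
      ≡ (+ 4 * + 1 - (+ 18 * n + + 12) * + 1 + (+ 27 * n ² + + 39 * n + + 12) * + 1
          - (+ 14 * n ³ + + 32 * n ² + + 22 * n + + 4)) * + 1
    identity = solve-∀
  identity : ∀ m k s p r q →
    let n = + 1 + m; K = + 1 + k
        _² = λ x → x * (x * + 1)
        _³ = λ x → x * (x * (x * + 1))
        P = λ k → + 4 * k ³ - (+ 18 * n + + 12) * k ² + (+ 27 * n ² + + 39 * n + + 12) * k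
          - (+ 14 * n ³ + + 32 * n ² + + 22 * n + + 4)
        c = - (n * (+ 7 * n ² + + 7 * n + + 2)) - + 8 * (n - K) ³ - P (+ 2 + k) in
    K ³ * (n * ((n + + 1) ² * s ³ + - (+ 7 * n ² + + 7 * n + + 2) * p ³ + - (+ 8 * n ²) * r ³))
      + (n * (n + + 1) ² * ((+ 1 + n) * q) ³ + (c * ((n - k) * q) ³ + - (+ 8) * K ³ * ((n - K) * p) ³))
    ≡ K ³ * (P (+ 2 + k) * p ³ - P K * q ³)
      + (n * (n + + 1) ² * (K * s) ³ + (c * (K * p) ³ + - (+ 8) * K ³ * (n * r) ³))
  identity = solve-∀
  step : ∀ m k s p r q → let n = + 1 + m; K = + 1 + k in
    K * s ≡ (+ 1 + n) * q → K * p ≡ (n - k) * q → n * r ≡ (n - K) * p →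
    K ^ 3 * (n * franelOperator n (s ^ 3) (p ^ 3) (r ^ 3))
    ≡ K ^ 3 * (franelCertificate n (+ 2 + k) * p ^ 3 - franelCertificate n K * q ^ 3)
  step m k s p r q h₁ h₂ h₃ = by-combination
    (cong₂ _+_ (cong (λ x → n * (n + + 1) ^ 2 * x ^ 3) h₁)
      (cong₂ _+_ (cong (λ x → c * x ^ 3) h₂) (cong (λ x → - (+ 8) * K ^ 3 * x ^ 3) h₃)))
    (identity m k s p r q)
    where
    n = + 1 + m
    K = + 1 + k
    -- All multiples of `p ^ 3`: from the operator, from eliminating `r`, and from the upper end of
    -- the telescoping difference.
    c = - (n * (+ 7 * n ^ 2 + + 7 * n + + 2)) - + 8 * (n - K) ^ 3 - franelCertificate n (+ 2 + k)

-- The expansion of the Franel numbers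

central-step : ∀ j → + suc j * binom (suc j *ℕ 2) (suc j) ≡ + 2 * + suc (j *ℕ 2) * binom (j *ℕ 2) j
central-step j = step (+ j) (+ (j *ℕ 2)) (binom (suc j *ℕ 2) (suc j)) (binom (suc (j *ℕ 2)) j) (binom (j *ℕ 2) j)
  (pos-* j 2) (absorption (suc (j *ℕ 2)) j) (upper-shift (j *ℕ 2) j)
  where
  step : ∀ j J v y u → J ≡ j * + 2 → (+ 1 + j) * v ≡ (+ 2 + J) * y → (+ 1 + J) * u ≡ (+ 1 + J - j) * y →
    (+ 1 + j) * v ≡ + 2 * (+ 1 + J) * u
  step j _ v y u refl h₁ h₂ = by-combination (cong₂ _+_ h₁ (cong (- (+ 2) *_) h₂)) (solve (j ∷ v ∷ y ∷ u ∷ []))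

-- (3j)! / j!³
trinomial : ℕ → ℤ
trinomial j = binom (j *ℕ 3) j * binom (j *ℕ 2) j

trinomial-step : ∀ j → (+ suc j) ^ 3 * trinomial (suc j)
  ≡ (+ 3 + + (j *ℕ 3)) * (+ 2 + + (j *ℕ 3)) * (+ 1 + + (j *ℕ 3)) * trinomial j
trinomial-step j = step (+ j) (+ (j *ℕ 2)) (+ (j *ℕ 3))
  (binom (j *ℕ 3) j) (binom (1 +ℕ j *ℕ 3) j) (binom (2 +ℕ j *ℕ 3) j) (binom (3 +ℕ j *ℕ 3) (suc j))
  (binom (j *ℕ 2) j) (binom (suc j *ℕ 2) (suc j)) (pos-* j 2) (pos-* j 3)
  (absorption (2 +ℕ j *ℕ 3) j) (upper-shift (1 +ℕ j *ℕ 3) j) (upper-shift (j *ℕ 3) j) (central-step j)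
  where
  group : ∀ k w v → k * (k * (k * + 1)) * (w * v) ≡ k * (k * w) * (k * v)
  group = solve-∀
  step : ∀ j J L x y z w u v → J ≡ j * + 2 → L ≡ j * + 3 →
    (+ 1 + j) * w ≡ (+ 3 + L) * z → (+ 2 + L) * y ≡ (+ 2 + L - j) * z → (+ 1 + L) * x ≡ (+ 1 + L - j) * y →
    (+ 1 + j) * v ≡ + 2 * (+ 1 + J) * u →
    (+ 1 + j) ^ 3 * (w * v) ≡ (+ 3 + L) * (+ 2 + L) * (+ 1 + L) * (x * u)
  step j _ _ x y z w u v refl refl h₁ h₂ h₃ h₄ = begin
    (+ 1 + j) ^ 3 * (w * v)                                     ≡⟨ group (+ 1 + j) w v ⟩
    (+ 1 + j) * ((+ 1 + j) * w) * ((+ 1 + j) * v)               ≡⟨ cong₂ (λ a b → (+ 1 + j) * a * b) h₁ h₄ ⟩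
    (+ 1 + j) * ((+ 3 + j * + 3) * z) * (+ 2 * (+ 1 + j * + 2) * u) ≡⟨ solve (j ∷ z ∷ u ∷ []) ⟩
    (+ 3 + j * + 3) * (+ 1 + j * + 2) * u * ((+ 2 + j * + 3 - j) * z) ≡⟨ cong ((+ 3 + j * + 3) * (+ 1 + j * + 2) * u *_) h₂ ⟨
    (+ 3 + j * + 3) * (+ 1 + j * + 2) * u * ((+ 2 + j * + 3) * y) ≡⟨ solve (j ∷ y ∷ u ∷ []) ⟩
    (+ 3 + j * + 3) * (+ 2 + j * + 3) * u * ((+ 1 + j * + 3 - j) * y) ≡⟨ cong ((+ 3 + j * + 3) * (+ 2 + j * + 3) * u *_) h₃ ⟨
    (+ 3 + j * + 3) * (+ 2 + j * + 3) * u * ((+ 1 + j * + 3) * x) ≡⟨ solve (j ∷ x ∷ u ∷ []) ⟩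
    (+ 3 + j * + 3) * (+ 2 + j * + 3) * (+ 1 + j * + 3) * (x * u) ∎

-- (−4)ⁿ⁻ʲ (n + 2j)! / ((n − j)! j!³)
expansionTerm : ℕ → ℕ → ℤ
expansionTerm n j = (- (+ 4)) ^ (n ∸ j) * (binom (j *ℕ 2 +ℕ n) (j *ℕ 3) * trinomial j)

index-< : ∀ {n j} → n < j → j *ℕ 2 +ℕ n < j *ℕ 3
index-< {n} {j} n<j = subst (j *ℕ 2 +ℕ n <_) (trans (+ℕ-comm (j *ℕ 2) j) (sym (*-suc j 2))) (+-monoʳ-< (j *ℕ 2) n<j)

expansion-coefficient-vanish : ∀ {n j} → n < j → binom (j *ℕ 2 +ℕ n) (j *ℕ 3) * trinomial j ≡ 0ℤ
expansion-coefficient-vanish {n} {j} n<j = cong (_* trinomial j) (binom-vanish (index-< n<j))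

expansionTerm-vanish : ∀ {n j} → n < j → expansionTerm n j ≡ 0ℤ
expansionTerm-vanish {n} {j} n<j =
  trans (cong ((- (+ 4)) ^ (n ∸ j) *_) (expansion-coefficient-vanish {n} {j} n<j)) (*-zeroʳ ((- (+ 4)) ^ (n ∸ j)))

-- The hypothesis covers the range where the truncated subtraction makes the exponents wrong.
raise-power : ∀ a m j x → (m < j → x ≡ 0ℤ) → a * (a ^ (m ∸ j) * x) ≡ a ^ (suc m ∸ j) * x
raise-power a m j x x≡0 with j ≤? m
... | yes j≤m = begin
  a * (a ^ (m ∸ j) * x)    ≡⟨ *-assoc a _ x ⟨
  a ^ suc (m ∸ j) * x      ≡⟨ cong (λ e → a ^ e * x) (+-∸-assoc 1 j≤m) ⟨
  a ^ (suc m ∸ j) * x      ∎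
... | no j≰m rewrite x≡0 (≰⇒> j≰m) = begin
  a * (a ^ (m ∸ j) * 0ℤ)   ≡⟨ cong (a *_) (*-zeroʳ (a ^ (m ∸ j))) ⟩
  a * 0ℤ                   ≡⟨ *-zeroʳ a ⟩
  0ℤ                       ≡⟨ *-zeroʳ (a ^ (suc m ∸ j)) ⟨
  a ^ (suc m ∸ j) * 0ℤ     ∎

-- The ratios x′/x = e/d and y′/y = d/a multiply to e/a: the common factor `d` drops out without any
-- division.
exchange : ∀ a d e p x y x′ y′ → d * x′ ≡ e * x → a * y′ ≡ d * y → a * (p * (x′ * y′)) ≡ e * (p * (x * y))
exchange a d e p x y x′ y′ h₁ h₂ = by-combination
  (cong₂ _+_ (cong (p * y *_) h₁) (cong (p * x′ *_) h₂))
  (solve (a ∷ d ∷ e ∷ p ∷ x ∷ y ∷ x′ ∷ y′ ∷ []))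

module _ (m j : ℕ) where
  private
    N = j *ℕ 2 +ℕ suc m
    K = j *ℕ 3
    t = expansionTerm (suc m) j
    -- Both the denominator of the binomial shifts and the numerator in `trinomial-step`, hence the
    -- factor that `exchange` removes.
    κ = (+ 3 + + K) * (+ 2 + + K) * (+ 1 + + K)

    lift : ∀ e x → κ * x ≡ e * binom N K →
      (+ suc j) ^ 3 * ((- (+ 4)) ^ (suc m ∸ j) * (x * trinomial (suc j))) ≡ e * t
    lift e x h = exchange ((+ suc j) ^ 3) κ e ((- (+ 4)) ^ (suc m ∸ j))
      (binom N K) (trinomial j) x (trinomial (suc j)) h (trinomial-step j)

  expansion-shift₂ : (+ suc j) ^ 3 * expansionTerm (2 +ℕ m) (suc j)
    ≡ (+ 3 + + N) * (+ 2 + + N) * (+ 1 + + N) * t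
  expansion-shift₂ = lift ((+ 3 + + N) * (+ 2 + + N) * (+ 1 + + N)) _
    (trans (cong (λ i → κ * binom (2 +ℕ i) (3 +ℕ K)) (+-suc (j *ℕ 2) (suc m))) (binom-shift₃₃ N K))

  expansion-shift₁ : (+ suc j) ^ 3 * (- (+ 4) * expansionTerm (1 +ℕ m) (suc j))
    ≡ (+ 2 + + N) * (+ 1 + + N) * (+ N - + K) * t
  expansion-shift₁ = trans
    (cong ((+ suc j) ^ 3 *_) (raise-power (- (+ 4)) m j _ (λ m<j → expansion-coefficient-vanish (s≤s m<j))))
    (lift ((+ 2 + + N) * (+ 1 + + N) * (+ N - + K)) _ (binom-shift₂₃ N K))

  -- Each factor -4 raises the exponent by one, here from `m ∸ suc j` to the exponent `suc m ∸ j` of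
  -- `t`; the vanishing binomials cover the truncated cases.
  expansion-shift₀ : (+ suc j) ^ 3 * (- (+ 4) * (- (+ 4) * expansionTerm m (suc j)))
    ≡ (+ 1 + + N) * (+ N - + K) * (+ N - + K - + 1) * t
  expansion-shift₀ = trans
    (cong ((+ suc j) ^ 3 *_) (trans
      (cong (- (+ 4) *_) (raise-power (- (+ 4)) m (suc j) _ expansion-coefficient-vanish))
      (raise-power (- (+ 4)) m j _ (λ m<j → expansion-coefficient-vanish (m<n⇒m<1+n m<j)))))
    (lift ((+ 1 + + N) * (+ N - + K) * (+ N - + K - + 1)) _
      (trans (cong (λ i → κ * binom (suc i) (3 +ℕ K)) (sym (+-suc (j *ℕ 2) m))) (binom-shift₁₃ N K)))

∑-expansionTerm-recurrence : FranelRecurrence (λ n → ∑< (suc n) (expansionTerm n))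
∑-expansionTerm-recurrence = zeilberger expansionTerm (λ _ → + 1)
  (λ m j → certificate (+ suc m) (+ j) * expansionTerm (suc m) j)
  (λ {n} {j} → expansionTerm-vanish {n} {j}) _
  (λ m → trans (cong (certificate (+ suc m) (+ (2 +ℕ m)) *_) (expansionTerm-vanish (n<1+n (suc m))))
               (*-zeroʳ (certificate (+ suc m) (+ (2 +ℕ m)))))
  (λ m → start (+ m) ((- (+ 4)) ^ m) _ _ _ _ (binom-0 (2 +ℕ m)) (binom-0 (1 +ℕ m)) (binom-0 m) (binom-0 0))
  -- `+ 16` is (-4)², matching the two factors -4 in `expansion-shift₀`; the cube clears the
  -- denominator of `trinomial-step`.
  (λ m j → *-cancelˡ-≡ (+ 16 * (+ suc j) ^ 3) _ _ ⦃ i*j≢0 (+ 16) ((+ suc j) ^ 3) ⦃ it ⦄ ⦃ ^-nonZero (+ suc j) 3 ⦄ ⦄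
    (step (+ m) (+ j) (+ (j *ℕ 2)) (+ (j *ℕ 3)) (expansionTerm (2 +ℕ m) (suc j)) (expansionTerm (1 +ℕ m) (suc j))
      (expansionTerm m (suc j)) (expansionTerm (suc m) j)
      (pos-* j 2) (pos-* j 3) (expansion-shift₂ m j) (expansion-shift₁ m j) (expansion-shift₀ m j)))
  where
  -- The ratio of the telescoped partial sum to `expansionTerm n j`; it is a polynomial, so the
  -- weight is 1.
  certificate : ℤ → ℤ → ℤ
  certificate n j = - (+ 3) * (+ 3 * n + + 2) * (n + + 1 + + 2 * j)
  start : ∀ m q a b c d → a ≡ + 1 → b ≡ + 1 → c ≡ + 1 → d ≡ + 1 →
    + 1 * franelOperator (+ 1 + m) (- (+ 4) * (- (+ 4) * q) * (a * (d * d)))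
      (- (+ 4) * q * (b * (d * d))) (q * (c * (d * d)))
    ≡ certificate (+ 1 + m) (+ 0) * (- (+ 4) * q * (b * (d * d)))
  start m q _ _ _ _ refl refl refl refl = identity m q
    where
    identity : ∀ m q → let n = + 1 + m
                           _² = λ x → x * (x * + 1) in
      + 1 * ((n + + 1) ² * (- (+ 4) * (- (+ 4) * q) * + 1)
        + - (+ 7 * n ² + + 7 * n + + 2) * (- (+ 4) * q * + 1) + - (+ 8 * n ²) * (q * + 1))
      ≡ - (+ 3) * (+ 3 * n + + 2) * (n + + 1 + + 2 * + 0) * (- (+ 4) * q * + 1)
    identity = solve-∀
  identity : ∀ m j t₂ t₁ t₀ t →
    let n = + 1 + m; J = + 1 + j; N = j * + 2 + n; K = j * + 3
        _² = λ x → x * (x * + 1)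
        _³ = λ x → x * (x * (x * + 1))
        H = λ j → - (+ 3) * (+ 3 * n + + 2) * (n + + 1 + + 2 * j)
        c = + 4 * (+ 7 * n ² + + 7 * n + + 2 + H J) in
    + 16 * J ³ * (+ 1 * ((n + + 1) ² * t₂ + - (+ 7 * n ² + + 7 * n + + 2) * t₁ + - (+ 8 * n ²) * t₀))
      + (+ 16 * (n + + 1) ² * ((+ 3 + N) * (+ 2 + N) * (+ 1 + N) * t)
      + (c * ((+ 2 + N) * (+ 1 + N) * (N - K) * t)
      + - (+ 8 * n ²) * ((+ 1 + N) * (N - K) * (N - K - + 1) * t)))
    ≡ + 16 * J ³ * (H J * t₁ - H j * t)
      + (+ 16 * (n + + 1) ² * (J ³ * t₂)
      + (c * (J ³ * (- (+ 4) * t₁)) + - (+ 8 * n ²) * (J ³ * (- (+ 4) * (- (+ 4) * t₀)))))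
  identity = solve-∀
  step : ∀ m j L K t₂ t₁ t₀ t → let n = + 1 + m; J = + 1 + j; N = L + n in
    L ≡ j * + 2 → K ≡ j * + 3 →
    J ^ 3 * t₂ ≡ (+ 3 + N) * (+ 2 + N) * (+ 1 + N) * t →
    J ^ 3 * (- (+ 4) * t₁) ≡ (+ 2 + N) * (+ 1 + N) * (N - K) * t →
    J ^ 3 * (- (+ 4) * (- (+ 4) * t₀)) ≡ (+ 1 + N) * (N - K) * (N - K - + 1) * t →
    + 16 * J ^ 3 * (+ 1 * franelOperator n t₂ t₁ t₀)
    ≡ + 16 * J ^ 3 * (certificate n J * t₁ - certificate n j * t)
  step m j _ _ t₂ t₁ t₀ t refl refl h₂ h₁ h₀ = by-combination
    (cong₂ _+_ (cong (+ 16 * (n + + 1) ^ 2 *_) h₂)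
      (cong₂ _+_ (cong (+ 4 * (+ 7 * n ^ 2 + + 7 * n + + 2 + certificate n (+ 1 + j)) *_) h₁)
                 (cong (- (+ 8 * n ^ 2) *_) h₀)))
    (identity m j t₂ t₁ t₀ t)
    where
    n = + 1 + m

opaque
  unfolding binom

  franel-expansion : ∀ n → + franel n ≡ ∑< (suc n) (expansionTerm n)
  franel-expansion n = trans (+franel n)
    (franelRecurrence-unique {λ n → ∑< (suc n) (franelTerm n)} {λ n → ∑< (suc n) (expansionTerm n)}
      -- The two `refl` compare initial values, computable with `binom` unfolded: 1 at 0, and 2 = -4
      -- + 6 at 1.
      ∑-franelTerm-recurrence ∑-expansionTerm-recurrence refl refl n)

-- The quotient sum and its first-order recurrence

-- (3j + 1)! / ((2j + 1) j!³)
quotientCoefficient : ℕ → ℤ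
quotientCoefficient j = binom (suc (j *ℕ 3)) j * binom (j *ℕ 2) j

-- `m` stands for n - 1, so the binomial is C(n + 2j, 3j + 1).
quotientTerm : ℕ → ℕ → ℤ
quotientTerm m j = (- (+ 4)) ^ (m ∸ j) * (binom (suc (j *ℕ 2 +ℕ m)) (suc (j *ℕ 3)) * quotientCoefficient j)

quotientCoefficient-trinomial : ∀ j →
  + suc (j *ℕ 2) * quotientCoefficient j ≡ + suc (j *ℕ 3) * trinomial j
quotientCoefficient-trinomial j = step (+ j) (+ (j *ℕ 2)) (+ (j *ℕ 3)) (binom (j *ℕ 3) j)
  (binom (suc (j *ℕ 3)) j) (binom (j *ℕ 2) j) (pos-* j 2) (pos-* j 3) (upper-shift (j *ℕ 3) j)
  where
  step : ∀ j J L x y u → J ≡ j * + 2 → L ≡ j * + 3 → (+ 1 + L) * x ≡ (+ 1 + L - j) * y →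
    (+ 1 + J) * (y * u) ≡ (+ 1 + L) * (x * u)
  step j _ _ x y u refl refl h = by-combination (cong (- u *_) h) (solve (j ∷ x ∷ y ∷ u ∷ []))

quotientTerm-expansionTerm : ∀ n j →
  + suc (j *ℕ 2) * quotientTerm n j ≡ + suc (j *ℕ 2 +ℕ n) * expansionTerm n j
quotientTerm-expansionTerm n j = exchange (+ suc (j *ℕ 2)) (+ suc (j *ℕ 3)) (+ suc (j *ℕ 2 +ℕ n))
  ((- (+ 4)) ^ (n ∸ j)) _ (trinomial j) _ (quotientCoefficient j)
  (absorption (j *ℕ 2 +ℕ n) (j *ℕ 3)) (quotientCoefficient-trinomial j)

quotientTerm-expansionTerm-suc : ∀ m j →
  + suc (j *ℕ 2) * (- (+ 4) * quotientTerm m j)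
    ≡ (+ (j *ℕ 2 +ℕ suc m) - + (j *ℕ 3)) * expansionTerm (suc m) j
quotientTerm-expansionTerm-suc m j = trans
  (cong (+ suc (j *ℕ 2) *_) (raise-power (- (+ 4)) m j _
    (λ m<j → cong (_* quotientCoefficient j) (binom-vanish (s≤s (index-< m<j))))))
  (exchange (+ suc (j *ℕ 2)) (+ suc (j *ℕ 3)) (+ (j *ℕ 2 +ℕ suc m) - + (j *ℕ 3))
    ((- (+ 4)) ^ (suc m ∸ j)) _ (trinomial j) _ (quotientCoefficient j)
    (trans (cong (λ i → + suc (j *ℕ 3) * binom i (suc (j *ℕ 3))) (sym (+-suc (j *ℕ 2) m)))
      (lower-shift (j *ℕ 2 +ℕ suc m) (j *ℕ 3)))
    (quotientCoefficient-trinomial j))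

-- This is the Gosper step in `k` for fixed `j`, with the factor n C(2n, n) divided out. Both
-- quotient terms are rational multiples of the same expansion term, and (2n + 1)(2j + n + 1) - 2n(n
-- - j) = (3n + 1)(2j + 1).
quotientTerm-recurrence : ∀ m j → let n = + suc m in
  + 1 * ((+ 2 * n + + 1) * quotientTerm (suc m) j + + 8 * n * quotientTerm m j
    + - (+ 3 * n + + 1) * expansionTerm (suc m) j) ≡ 0ℤ
quotientTerm-recurrence m j = *-cancelˡ-≡ (+ suc (j *ℕ 2)) _ 0ℤ
  (step (+ m) (+ j) (+ (j *ℕ 2)) (+ (j *ℕ 3)) (quotientTerm (suc m) j) (quotientTerm m j) (expansionTerm (suc m) j)
    (pos-* j 2) (pos-* j 3) (quotientTerm-expansionTerm (suc m) j) (quotientTerm-expansionTerm-suc m j))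
  where
  step : ∀ m j J K r s t → J ≡ j * + 2 → K ≡ j * + 3 → let n = + 1 + m in
    (+ 1 + J) * r ≡ (+ 1 + (J + n)) * t → (+ 1 + J) * (- (+ 4) * s) ≡ (J + n - K) * t →
    (+ 1 + J) * (+ 1 * ((+ 2 * n + + 1) * r + + 8 * n * s + - (+ 3 * n + + 1) * t)) ≡ (+ 1 + J) * 0ℤ
  step m j _ _ r s t refl refl h₁ h₂ = by-combination
    (cong₂ _+_ (cong ((+ 2 * (+ 1 + m) + + 1) *_) h₁) (cong (- (+ 2 * (+ 1 + m)) *_) h₂))
    (solve (m ∷ j ∷ r ∷ s ∷ t ∷ []))

quotientSum : ℕ → ℤ
quotientSum m = ∑< (suc m) (quotientTerm m)

quotientSum-recurrence : ∀ m → let n = + suc m in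
  (+ 2 * n + + 1) * quotientSum (suc m) + + 8 * n * quotientSum m + - (+ 3 * n + + 1) * + franel (suc m) ≡ 0ℤ
quotientSum-recurrence m = *-cancelˡ-≡ (+ 1) _ 0ℤ (trans
  (cong₂ (λ g h → + 1 * ((+ 2 * n + + 1) * quotientSum (suc m) + + 8 * n * g + - (+ 3 * n + + 1) * h))
    (sym (∑<-extend (suc m) (quotientTerm m) vanish)) (franel-expansion (suc m)))
  -- The relation holds for every `j` separately, so the certificate is zero.
  (∑<-telescope (+ 1) (+ 2 * n + + 1) (+ 8 * n) (- (+ 3 * n + + 1))
    (quotientTerm (suc m)) (quotientTerm m) (expansionTerm (suc m)) (λ _ → 0ℤ)
    (quotientTerm-recurrence m 0) (λ j → quotientTerm-recurrence m (suc j)) (suc m)))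
  where
  n = + suc m
  vanish : quotientTerm m (suc m) ≡ 0ℤ
  vanish = trans
    (cong (λ x → (- (+ 4)) ^ (m ∸ suc m) * (x * quotientCoefficient (suc m)))
      (binom-vanish (s≤s (index-< (n<1+n m)))))
    (*-zeroʳ ((- (+ 4)) ^ (m ∸ suc m)))

-- The weighted sum in terms of the quotient sum

-- The hypothesis is restricted to `k < n` because raising `n` adds one to the exponent `n ∸ k ∸ 1`
-- only there.
∑<-scale : ∀ c n {f g : ℕ → ℤ} → (∀ k → k < n → f k ≡ c * g k) → ∑< n f ≡ c * ∑< n g
∑<-scale c zero    eq = sym (*-zeroʳ c)
∑<-scale c (suc n) {f} {g} eq = begin
  f 0 + ∑< n (f ∘ suc)          ≡⟨ cong₂ _+_ (eq 0 (s≤s z≤n)) (∑<-scale c n (λ k k<n → eq (suc k) (s≤s k<n))) ⟩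
  c * g 0 + c * ∑< n (g ∘ suc)  ≡⟨ *-distribˡ-+ c (g 0) _ ⟨
  c * (g 0 + ∑< n (g ∘ suc))    ∎

∑<-∣ : ∀ {d} n {f : ℕ → ℤ} → (∀ k → d ∣ f k) → d ∣ ∑< n f
∑<-∣ zero    d∣f = divides 0ℤ refl
∑<-∣ (suc n) d∣f = ∣m∣n⇒∣m+n (d∣f 0) (∑<-∣ n (d∣f ∘ suc))

weightedTerm : ℕ → ℕ → ℤ
weightedTerm n k = + (3 *ℕ k +ℕ 1) * (- (+ 16)) ^ (n ∸ k ∸ 1) * + ((2 *ℕ k) C k) * + franel k

weightedSum : ℕ → ℤ
weightedSum n = ∑< n (weightedTerm n)

central-binom : ∀ n → + ((2 *ℕ n) C n) ≡ binom (n *ℕ 2) n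
central-binom n = trans (cong (λ i → + (i C n)) (*ℕ-comm 2 n)) (binom-C (n *ℕ 2) n)

weightedSum-suc : ∀ n →
  weightedSum (suc n) ≡ - (+ 16) * weightedSum n + (+ 3 * + n + + 1) * binom (n *ℕ 2) n * + franel n
weightedSum-suc n = trans (∑<-last n (weightedTerm (suc n)))
  (cong₂ _+_ (∑<-scale (- (+ 16)) n scale) last)
  where
  move : ∀ a c p b f → a * (c * p) * b * f ≡ c * (a * p * b * f)
  move = solve-∀
  scale : ∀ k → k < n → weightedTerm (suc n) k ≡ - (+ 16) * weightedTerm n k
  scale k k<n = trans
    (cong (λ e → + (3 *ℕ k +ℕ 1) * (- (+ 16)) ^ e * + ((2 *ℕ k) C k) * + franel k) exponent)
    (move (+ (3 *ℕ k +ℕ 1)) (- (+ 16)) ((- (+ 16)) ^ (n ∸ k ∸ 1)) (+ ((2 *ℕ k) C k)) (+ franel k))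
    where
    exponent : suc n ∸ k ∸ 1 ≡ suc (n ∸ k ∸ 1)
    exponent = begin
      suc n ∸ k ∸ 1        ≡⟨ cong (_∸ 1) (+-∸-assoc 1 (<⇒≤ k<n)) ⟩
      n ∸ k                ≡⟨ suc-pred (n ∸ k) ⦃ >-nonZero (m<n⇒0<n∸m k<n) ⦄ ⟨
      suc (n ∸ k ∸ 1)      ∎
  last : weightedTerm (suc n) n ≡ (+ 3 * + n + + 1) * binom (n *ℕ 2) n * + franel n
  last = cong (_* + franel n) (cong₂ _*_
    (trans (cong (λ e → + (3 *ℕ n +ℕ 1) * (- (+ 16)) ^ (e ∸ 1)) (m+n∸n≡m 1 n))
      (trans (*-identityʳ _) (cong (λ x → x + + 1) (pos-* 3 n))))
    (central-binom n))

-- Induction: `weightedSum-suc` and `quotientSum-recurrence` make both sides obey the same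
-- first-order recurrence in n. The factor 2 stays on the left until the quotient sum is known to be
-- even.
2*weightedSum : ∀ m →
  + 2 * weightedSum (suc m) ≡ + suc m * binom (suc m *ℕ 2) (suc m) * quotientSum m
2*weightedSum zero    = base
  where
  opaque
    unfolding binom
    base : + 2 * weightedSum 1 ≡ + 1 * binom 2 1 * quotientSum 0
    base = refl
2*weightedSum (suc m) = step (+ suc m) (weightedSum (2 +ℕ m)) (weightedSum (1 +ℕ m)) (binom (suc m *ℕ 2) (suc m))
  (binom ((2 +ℕ m) *ℕ 2) (2 +ℕ m)) (+ franel (suc m)) (quotientSum m) (quotientSum (suc m)) (+ (suc m *ℕ 2))
  (pos-* (suc m) 2)
  (weightedSum-suc (suc m)) (2*weightedSum m) (quotientSum-recurrence m) (central-step (suc m))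
  where
  step : ∀ n S′ S D D′ f R R′ N → N ≡ n * + 2 →
    S′ ≡ - (+ 16) * S + (+ 3 * n + + 1) * D * f → + 2 * S ≡ n * D * R →
    (+ 2 * n + + 1) * R′ + + 8 * n * R + - (+ 3 * n + + 1) * f ≡ 0ℤ →
    (+ 1 + n) * D′ ≡ + 2 * (+ 1 + N) * D →
    + 2 * S′ ≡ (+ 1 + n) * D′ * R′
  step n _ S D D′ f R R′ _ refl refl h₁ h₂ h₃ = by-combination
    -- Multiplied by `2 * D`, the quotient recurrence has leading term `(+ 1 + n) * D′ * R′` by
    -- `h₃`, and its middle term becomes `+ 16 * (+ 2 * S)` by `h₁`.
    (cong₂ _+_ (cong (- (+ 16) *_) h₁) (cong₂ _+_ (cong (- (+ 2 * D) *_) h₂) (cong (- R′ *_) h₃)))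
    (solve (n ∷ S ∷ D ∷ D′ ∷ f ∷ R ∷ R′ ∷ []))

-- Parity and the final divisibility

-- Pascal's rule splits C(2i + 2, i + 1) into C(2i + 1, i) and C(2i + 1, i + 1), which are equal by
-- symmetry.
2∣central : ∀ i → + 2 ∣ binom (suc i *ℕ 2) (suc i)
2∣central i = divides (binom (suc (i *ℕ 2)) i) (step _ _ _ (pascal (suc (i *ℕ 2)) i) middle)
  where
  middle : binom (suc (i *ℕ 2)) (suc i) ≡ binom (suc (i *ℕ 2)) i
  middle = *-cancelˡ-≡ (+ suc i) _ _ (trans (lower-shift (suc (i *ℕ 2)) i)
    (cong (_* binom (suc (i *ℕ 2)) i) (width (+ i) (+ (i *ℕ 2)) (pos-* i 2))))
    where
    width : ∀ i I → I ≡ i * + 2 → + 1 + I - i ≡ + 1 + i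
    width i _ refl = solve (i ∷ [])
  step : ∀ x y z → x ≡ y + z → z ≡ y → x ≡ y * + 2
  step _ y _ refl refl = solve (y ∷ [])

-- The index `suc m` is where n > 1 enters: at `j = 0` the power of -4 has positive exponent,
-- whereas for n = 1 the single term would be 1.
2∣quotientTerm : ∀ m j → + 2 ∣ quotientTerm (suc m) j
2∣quotientTerm m zero    = ∣m⇒∣m*n _ (∣m⇒∣m*n ((- (+ 4)) ^ m) (divides (- (+ 2)) refl))
2∣quotientTerm m (suc i) = ∣n⇒∣m*n ((- (+ 4)) ^ (m ∸ i)) (∣n⇒∣m*n (binom _ _) (∣n⇒∣m*n (binom _ _) (2∣central i)))

theorem1p1 : (n : ℕ) → 1 < n →
    + (n *ℕ ((2 *ℕ n) C n)) ∣
    ∑< n (λ k → + (3 *ℕ k +ℕ 1) * (- (+ 16)) ^ (n ∸ k ∸ 1) * + ((2 *ℕ k) C k) * + franel k)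
theorem1p1 (suc (suc m)) _ = divide (∑<-∣ (2 +ℕ m) (2∣quotientTerm m))
  where
  n = suc (suc m)
  double : ∀ S n D R q → + 2 * S ≡ n * D * R → R ≡ q * + 2 → + 2 * S ≡ + 2 * (q * (n * D))
  double S n D _ q h refl = by-combination h (solve (S ∷ n ∷ D ∷ q ∷ []))
  modulus : + (n *ℕ ((2 *ℕ n) C n)) ≡ + n * binom (n *ℕ 2) n
  modulus = trans (pos-* n ((2 *ℕ n) C n)) (cong (+ n *_) (central-binom n))
  divide : + 2 ∣ quotientSum (suc m) → + (n *ℕ ((2 *ℕ n) C n)) ∣ weightedSum n
  -- The cofactor `q` is half the quotient sum; the 2 in `2*weightedSum` cancels against its
  -- evenness.
  divide (divides q eq) = divides q (trans
    (*-cancelˡ-≡ (+ 2) (weightedSum n) _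
      (double (weightedSum n) (+ n) (binom (n *ℕ 2) n) (quotientSum (suc m)) q (2*weightedSum (suc m)) eq))
    (cong (q *_) (sym modulus)))
theorem1p1 (suc zero) (s≤s ())
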